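{- Let $G = (S, s_0, S_{EGO}, S_{ALTER}, \Sigma_{EGO}, \Sigma_{ALTER}, \rightarrow, CC_{EGO})$ be a two-player game with counting constraints, and let $\varphi$ be a strategy of player $EGO$. 1. Let $CC_{max}(EGO, a, k, l) \in CC_{EGO}$ with $k \leq l-1$. If $\varphi$ is a winning strategy for $EGO$ on $G$, then $\varphi$ is also a winning strategy for $EGO$ on $G'$, where $G'$ is the game with counting constraints that equals $G$ except that the constraint $CC_{max}(EGO, a, k, l)$ is replaced by $CC_{max}(EGO, a, k, l-1)$. 2. Let $CC_{min}(EGO, a, k, l) \in CC_{EGO}$. If $\varphi$ is a winning strategy for $EGO$ on $G$, then $\varphi$ is also a winning strategy for $EGO$ on $G'$, where $G'$ is the game with counting constraints that equals $G$ except that the constraint $CC_{min}(EGO, a, k, l)$ is replaced by $CC_{min}(EGO, a, k, l+1)$.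
   Context: $\mathbb{N}$ denotes the positive integers and $\mathbb{N}_0 = \mathbb{N} \cup \{0\}$. **Two-player game graph.** A two-player finite-state game graph is $(S, s_0, S_{EGO}, S_{ALTER}, \Sigma_{EGO}, \Sigma_{ALTER}, \rightarrow)$ where $S$ is a finite non-empty set of states, $S_{EGO}, S_{ALTER}$ partition $S$, $s_0 \in S_{EGO}$ is the initial state, $\Sigma_{EGO}$ and $\Sigma_{ALTER}$ are finite alphabets of actions of the players $EGO$ and $ALTER$, and $\rightarrow \subseteq S \times (\Sigma_{EGO} \cup \Sigma_{ALTER}) \times S$ is a set of labeled transitions such that: - (bipartition) each $(s,\sigma,s') \in \rightarrow$ has either $s \in S_{EGO}, s' \in S_{ALTER}$ or $s \in S_{ALTER}, s' \in S_{EGO}$; - (no deadlock) for each $s \in S$ there are $\sigma$ and $s'$ with $(s,\sigma,s') \in \rightarrow$; - (alphabet restriction) for each player $p$, if $(s,\sigma,s') \in \rightarrow$ with $s \in S_p$, then $\sigma \in \Sigma_p$; - (determinacy of moves) if $(s,\sigma,s'), (s,\sigma,s'') \in \rightarrow$, then $s' = s''$. **Plays and prefixes.** An infinite play is an infinite sequence $\pi = \pi_0 \sigma_0 \pi_1 \sigma_1 \dots$ with $\pi_0 = s_0$ and $(\pi_i, \sigma_i, \pi_{i+1}) \in \rightarrow$ for all $i \in \mathbb{N}_0$. Since $s_0 \in S_{EGO}$, the actions of $EGO$ are exactly those at even indices, $\sigma_0, \sigma_2, \sigma_4, \dots$. The prefix of $\pi$ up to position $n$ is $\pi(n) = \pi_0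 \sigma_0 \pi_1 \dots \sigma_{n-1} \pi_n$; its tail is $\pi_n$. **Strategies.** A strategy of $EGO$ is a mapping $\varphi$ from the set of all prefixes of plays whose tail lies in $S_{EGO}$ to $2^{\Sigma_{EGO}}$, such that for every such prefix $\pi(n)$ and every $\sigma \in \varphi(\pi(n))$ there is a state $s \in S \setminus S_{EGO}$ with $(\pi_n, \sigma, s) \in \rightarrow$. The outcome $O(G,\varphi)$ of a strategy $\varphi$ of $EGO$ is the set of all infinite plays $\pi = (\pi_i \sigma_i)_{i \in \mathbb{N}_0}$ on the game graph of $G$ with $\sigma_{2i} \in \varphi(\pi(2i))$ for all $i \in \mathbb{N}_0$. **Window counting constraints.** Let $a \in \Sigma_{EGO}$ be an action and $k, l \in \mathbb{N}$ with $k \leq l$. The following are defined for an infinite play $\pi = (\pi_i \sigma_i)_{i \in \mathbb{N}_0}$. - $CC_{max}(EGO, a, k, l)$ ("$EGO$ plays action $a$ at most $k$ times out of $l$ of its own turns") is satisfied on $\pi$ if for all $i \in \mathbb{N}_0$: $|\{m \mid i \leq m \leq i+l-1,\ \sigma_{2m} = a\}| \leq k$. - $CC_{min}(EGO, a, k, l)$ ("$EGO$ plays action $a$ at least $k$ times out of $l$ of its own turns") is satisfied on $\pi$ if for all $i \in \mathbb{N}_0$: $|\{m \mid i \leq m \leq i+l-1,\ \sigma_{2m} = a\}| \geq k$. **Games with counting constraints.** A two-player game with counting constraints consists of a two-player finite-state game graph together with a finite set $CC_{EGO}$ of counting constraints of the form $CC_{min}(EGO, a, k, l)$ or $CC_{max}(EGO,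 a, k, l)$ with $a \in \Sigma_{EGO}$, $k, l \in \mathbb{N}$, $k \leq l$. $EGO$ wins a play if the play satisfies all constraints in $CC_{EGO}$; otherwise $ALTER$ wins. A strategy $\varphi$ of $EGO$ is a winning strategy if $EGO$ wins all plays in $O(G,\varphi)$. -}

module Defs where

open import Data.Empty using (⊥-elim)
open import Data.Fin using (Fin)
import Data.Fin.Properties as Fin
open import Data.Fin.Subset using (Subset; _∈_; _∉_; _⊆_; _∪_; _∩_; ⊤; ⊥)
open import Data.Fin.Subset.Properties using (∉⊥; x∈p∩q⁺)
open import Data.List using (List; _∷_; applyUpTo; filter; length)
import Data.List.Membership.Propositional as List
open import Data.List.Relation.Unary.All using (All; _∷_; lookup)
open import Data.List.Relation.Unary.All.Properties using (filter⁺)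
open import Data.Nat using (ℕ; zero; suc; _+_; _*_; _∸_; _≤_; _≥_)
import Data.Nat.Properties as ℕ
open import Data.Product using (∃; _×_; _,_)
open import Data.Sum using (_⊎_; inj₁; inj₂)
open import Level using (0ℓ)
open import Relation.Binary.Definitions using (DecidableEquality)
open import Relation.Binary.PropositionalEquality using (_≡_; refl; sym; subst)
open import Relation.Nullary using (no)
open import Relation.Nullary.Decidable using (map′; _×-dec_; ¬?)
open import Relation.Unary using (Pred)

data Player : Set where
  EGO ALTER : Player

-- The two alphabets may overlap; `Action` is exactly their union.
record GameGraph : Set₁ where
  field
    #states  : ℕ
    #actions : ℕ

  State  = Fin #states
  Action = Fin #actions

  field
    owned           : Player → Subset #states
    owned-cover     : owned EGO ∪ owned ALTER ≡ ⊤
    owned-disjoint  : owned EGO ∩ owned ALTER ≡ ⊥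
    s₀              : State
    s₀∈EGO          : s₀ ∈ owned EGO
    alphabet        : Player → Subset #actions
    alphabet-cover  : alphabet EGO ∪ alphabet ALTER ≡ ⊤
    _—[_]→_         : State → Action → State → Set
    bipartition     : ∀ {s σ s′} → s —[ σ ]→ s′ →
                      (s ∈ owned EGO × s′ ∈ owned ALTER) ⊎
                      (s ∈ owned ALTER × s′ ∈ owned EGO)
    no-deadlock     : ∀ s → ∃ λ σ → ∃ λ s′ → s —[ σ ]→ s′
    alphabet-restr  : ∀ p {s σ s′} → s —[ σ ]→ s′ → s ∈ owned p → σ ∈ alphabet p
    determinacy     : ∀ {s σ s′ s″} → s —[ σ ]→ s′ → s —[ σ ]→ s″ → s′ ≡ s″

module _ (A : GameGraph) where
  open GameGraph A

  record Play : Set where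
    field
      state  : ℕ → State
      action : ℕ → Action
      init   : state 0 ≡ s₀
      step   : ∀ i → state i —[ action i ]→ state (suc i)

  -- π₀ σ₀ π₁ … σₙ₋₁ πₙ is represented by
  -- moves = (π₀ , σ₀) ∷ … ∷ (πₙ₋₁ , σₙ₋₁) ∷ [] and tail = πₙ.
  record History : Set where
    constructor history
    field
      moves : List (State × Action)
      tail  : State

open History using (tail)

module _ {A : GameGraph} where
  open GameGraph A

  prefix : Play A → ℕ → History A
  prefix π n = history (applyUpTo (λ i → state i , action i) n) (state n)
    where open Play π

  IsPrefix : History A → Set
  IsPrefix h = ∃ λ π → ∃ λ n → prefix π n ≡ h

  private
    exclusive : ∀ {s} → s ∈ owned EGO → s ∉ owned ALTER
    exclusive e a = ∉⊥ (subst (_ ∈_) owned-disjoint (x∈p∩q⁺ (e , a)))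

    EGO→ALTER : ∀ {s σ s′} → s —[ σ ]→ s′ → s ∈ owned EGO → s′ ∈ owned ALTER
    EGO→ALTER t e with bipartition t
    ... | inj₁ (_ , a) = a
    ... | inj₂ (a , _) = ⊥-elim (exclusive e a)

    ALTER→EGO : ∀ {s σ s′} → s —[ σ ]→ s′ → s ∈ owned ALTER → s′ ∈ owned EGO
    ALTER→EGO t a with bipartition t
    ... | inj₁ (e , _) = ⊥-elim (exclusive e a)
    ... | inj₂ (_ , e) = e

  even-EGO : (π : Play A) → ∀ i → Play.state π (2 * i) ∈ owned EGO
  even-EGO π zero    = subst (_∈ owned EGO) (sym (Play.init π)) s₀∈EGO
  even-EGO π (suc i) =
    subst (λ n → Play.state π n ∈ owned EGO) (sym (ℕ.*-suc 2 i))
      (ALTER→EGO (step (suc (2 * i))) (EGO→ALTER (step (2 * i)) (even-EGO π i)))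
    where open Play π

-- The membership proofs are irrelevant arguments, so that a strategy depends only on the
-- sequence of states and actions.
record Strategy (A : GameGraph) : Set where
  open GameGraph A
  field
    choice   : (h : History A) → .(IsPrefix h) → .(tail h ∈ owned EGO) → Subset #actions
    choice-⊆ : ∀ h .(p : IsPrefix h) .(e : tail h ∈ owned EGO) →
               choice h p e ⊆ alphabet EGO
    enabled  : ∀ h .(p : IsPrefix h) .(e : tail h ∈ owned EGO) {σ} → σ ∈ choice h p e →
               ∃ λ s → s ∉ owned EGO × tail h —[ σ ]→ s

Outcome : ∀ {A} → Strategy A → Pred (Play A) 0ℓ
Outcome φ π = ∀ i →
  Play.action π (2 * i) ∈
    Strategy.choice φ (prefix π (2 * i)) (π , 2 * i , refl) (even-EGO π i)

data Constraint (A : GameGraph) : Set where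
  CCmax CCmin : (a : GameGraph.Action A) (k l : ℕ) → Constraint A

module _ {A : GameGraph} where
  open GameGraph A

  Admissible : Action → ℕ → ℕ → Set
  Admissible a k l = a ∈ alphabet EGO × 1 ≤ k × 1 ≤ l × k ≤ l

  data WellFormed : Constraint A → Set where
    wf-max : ∀ {a k l} → Admissible a k l → WellFormed (CCmax a k l)
    wf-min : ∀ {a k l} → Admissible a k l → WellFormed (CCmin a k l)

  -- The list i , i + 1 , … , i + l - 1 has no repetitions, so this is the cardinality of
  -- { m ∣ i ≤ m ≤ i + l - 1 , σ₂ₘ = a }.
  occurrences : Play A → Action → (i l : ℕ) → ℕ
  occurrences π a i l =
    length (filter (λ m → Play.action π (2 * m) Fin.≟ a) (applyUpTo (i +_) l))

  _⊨_ : Play A → Constraint A → Set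
  π ⊨ CCmax a k l = ∀ i → occurrences π a i l ≤ k
  π ⊨ CCmin a k l = ∀ i → occurrences π a i l ≥ k

  _≟ᶜ_ : DecidableEquality (Constraint A)
  CCmax a k l ≟ᶜ CCmax b m n =
    map′ (λ { (refl , refl , refl) → refl }) (λ { refl → refl , refl , refl })
         ((a Fin.≟ b) ×-dec (k ℕ.≟ m) ×-dec (l ℕ.≟ n))
  CCmin a k l ≟ᶜ CCmin b m n =
    map′ (λ { (refl , refl , refl) → refl }) (λ { refl → refl , refl , refl })
         ((a Fin.≟ b) ×-dec (k ℕ.≟ m) ×-dec (l ℕ.≟ n))
  CCmax _ _ _ ≟ᶜ CCmin _ _ _ = no λ ()
  CCmin _ _ _ ≟ᶜ CCmax _ _ _ = no λ ()

-- `CC` stands for the finite set of its elements; order and repetitions are immaterial.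
record Game : Set₁ where
  field
    graph       : GameGraph
    CC          : List (Constraint graph)
    well-formed : All WellFormed CC

open Game

EGOWins : (G : Game) → Pred (Play (graph G)) 0ℓ
EGOWins G π = All (π ⊨_) (CC G)

Winning : (G : Game) → Pred (Strategy (graph G)) 0ℓ
Winning G φ = ∀ π → Outcome φ π → EGOWins G π

-- The constraint set becomes (CC ∖ {c}) ∪ {c′}; all copies of c are removed because CC
-- stands for a set.
replace : (G : Game) (c c′ : Constraint (graph G)) → WellFormed c′ → Game
replace G c c′ w = record
  { graph       = graph G
  ; CC          = c′ ∷ filter (λ d → ¬? (d ≟ᶜ c)) (CC G)
  ; well-formed = w ∷ filter⁺ (λ d → ¬? (d ≟ᶜ c)) (well-formed G)
  }

shortenMax : (G : Game) → ∀ a k l → CCmax a k l List.∈ CC G → k ≤ l ∸ 1 → Game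
shortenMax G a k l c∈ k≤l-1 = replace G (CCmax a k l) (CCmax a k (l ∸ 1)) wf
  where
  wf : WellFormed (CCmax a k (l ∸ 1))
  wf with lookup (well-formed G) c∈
  ... | wf-max (a∈ , 1≤k , _) = wf-max (a∈ , 1≤k , ℕ.≤-trans 1≤k k≤l-1 , k≤l-1)

lengthenMin : (G : Game) → ∀ a k l → CCmin a k l List.∈ CC G → Game
lengthenMin G a k l c∈ = replace G (CCmin a k l) (CCmin a k (l + 1)) wf
  where
  wf : WellFormed (CCmin a k (l + 1))
  wf with lookup (well-formed G) c∈
  ... | wf-min (a∈ , 1≤k , 1≤l , k≤l) =
    wf-min (a∈ , 1≤k , ℕ.≤-trans 1≤l (ℕ.m≤m+n l 1) , ℕ.≤-trans k≤l (ℕ.m≤m+n l 1))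

{-# OPTIONS --safe #-}
module Submission where

open import Defs
open import Data.List using (applyUpTo)
open import Data.List.Membership.Propositional using (_∈_)
open import Data.List.Relation.Binary.Sublist.Propositional using (_⊆_; _∷_; minimum)
open import Data.List.Relation.Binary.Sublist.Propositional.Properties
  using (filter⁺; length-mono-≤)
import Data.List.Relation.Unary.All as All
import Data.List.Relation.Unary.All.Properties as All
import Data.Fin.Properties as Fin
open import Data.Nat using (ℕ; suc; _+_; _*_; _≤_; _∸_; z≤n; s≤s)
open import Data.Nat.Properties using (≤-trans; m∸n≤m; m≤m+n)
open import Data.Product using (_×_; _,_)
open import Function using (_∘_)
open import Relation.Binary.PropositionalEquality using (refl)
open Game

-- For a fixed starting turn `i`, the count of `a` is monotone in the window length. So an upper
-- bound passes to the shorter window and a lower bound to the longer one, on every single play.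
-- Changing a constraint leaves the graph alone, hence `φ` keeps its outcome.

applyUpTo-mono-⊆ : ∀ {a} {A : Set a} (f : ℕ → A) {m n} → m ≤ n → applyUpTo f m ⊆ applyUpTo f n
applyUpTo-mono-⊆ f z≤n       = minimum _
applyUpTo-mono-⊆ f (s≤s m≤n) = refl ∷ applyUpTo-mono-⊆ (f ∘ suc) m≤n

-- Both windows start at `i`, so the shorter is a sublist of the longer, and filtering both by the
-- same test preserves this.
occurrences-mono-≤ : ∀ {A} (π : Play A) a i {l l′} → l ≤ l′ →
                     occurrences π a i l ≤ occurrences π a i l′
occurrences-mono-≤ π a i l≤l′ =
  length-mono-≤ (filter⁺ P? P? (λ { refl p → p }) (applyUpTo-mono-⊆ (i +_) l≤l′))
  where P? = λ m → Play.action π (2 * m) Fin.≟ a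

-- Each outcome play already satisfies all of `CC G`: `c` yields `c′`, and the constraints that
-- survive the filter are among those satisfied.
replace-Winning : ∀ (G : Game) {c c′} (w : WellFormed c′) (φ : Strategy (graph G)) →
                  c ∈ CC G → (∀ π → π ⊨ c → π ⊨ c′) →
                  Winning G φ → Winning (replace G c c′ w) φ
replace-Winning G w φ c∈ c⇒c′ win π π∈φ =
  c⇒c′ π (All.lookup wins c∈) All.∷ All.filter⁺ _ wins
  where wins = win π π∈φ

theorem4p1 : (G : Game) (φ : Strategy (graph G)) →
    (∀ a k l (c∈ : CCmax a k l ∈ CC G) (k≤l-1 : k ≤ l ∸ 1) →
    Winning G φ → Winning (shortenMax G a k l c∈ k≤l-1) φ)
    ×
    (∀ a k l (c∈ : CCmin a k l ∈ CC G) →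
    Winning G φ → Winning (lengthenMin G a k l c∈) φ)
theorem4p1 G φ =
  (λ a k l c∈ k≤l-1 →
    -- Taking the head recovers the proof local to `shortenMax`, so the two games agree
    -- definitionally.
    replace-Winning G (All.head (well-formed (shortenMax G a k l c∈ k≤l-1))) φ c∈ λ π most i →
      ≤-trans (occurrences-mono-≤ π a i (m∸n≤m l 1)) (most i)) ,
  (λ a k l c∈ →
    replace-Winning G (All.head (well-formed (lengthenMin G a k l c∈))) φ c∈ λ π least i →
      -- Here the bound comes first: lengthening the window cannot lower a count that has reached
      -- `k`.
      ≤-trans (least i) (occurrences-mono-≤ π a i (m≤m+n l 1)))
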